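{- Let $G\in\mathscr{B}$ with $\operatorname{diam}(G)\ge 4$ and let $T_G$ be its associated tree. (i) Suppose $\operatorname{diam}(G)$ is even and $C(T_G)=\{z\}$, where $z\in V_1(B)$ for some block $B$ of $G$. Then $C(G)=\{z\}$ if $z\in C_G$, and $C(G)=V_1(B)$ if $z\notin C_G$. (ii) Suppose $\operatorname{diam}(G)$ is odd and $C(T_G)=\{z_1,z_2\}$, where $z_1\in V_1(B)$ and $z_2\in V_2(B)$ for some block $B$ of $G$. Then $C(G)=\{z_1,z_2\}$ if $z_1,z_2\in C_G$; $C(G)=\{z_1\}\cup V_2(B)$ if $z_1\in C_G$ and $z_2\notin C_G$; $C(G)=\{z_2\}\cup V_1(B)$ if $z_1\notin C_G$ and $z_2\in C_G$.
   Context: All graphs are finite, simple and connected. For a connected graph $H$, $e_H(u)=\max\{d_H(u,v):v\in V_H\}$, $\operatorname{rad}(H)=\min_u e_H(u)$, $\operatorname{diam}(H)=\max_u e_H(u)$, and the center $C(H)$ is the set of vertices $u$ with $e_H(u)=\operatorname{rad}(H)$. A block is a maximal connected subgraph without a cut-vertex; $C_G$ is the set of cut-vertices of $G$. A bi-block graph is a connected graph all of whose blocks are complete bipartite graphs. $\mathscr{B}$ is the class of bi-block graphs with at least two blocks in which every block contains at most two cut-vertices of $G$. For a block $B$, $(V_1(B),V_2(B))$ is its bipartition; $B$ is a leaf block if $|V_B\cap C_G|=1$. Vertices of $G$ are labelled $v_1,\dots,v_n$. Construction of $T_G$ (which is a tree): for a block $B$ and $i=1,2$, let $u_i$ be the non-cut-vertex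 of minimum label in $V_i(B)$, if it exists. If $B\neq K_{1,1}$: $NC_B=\{u_2\}$ if $|V_1(B)\cap C_G|=2$; $NC_B=\{u_1\}$ if $|V_2(B)\cap C_G|=2$; $NC_B=\{u_1,u_2\}$ if $B$ is a leaf block; $NC_B=\emptyset$ otherwise. If $B=K_{1,1}$: $NC_B=\{u_1,u_2\}\cap V_B$. $T_G$ is the subgraph of $G$ induced by $\bigcup_B NC_B\cup C_G$. -}

module Defs where

open import Data.Nat using (ℕ; zero; suc; _≤_)
open import Data.Fin using (Fin; toℕ)
open import Data.Bool using (Bool; true; false)
open import Data.Unit using (⊤)
open import Data.Empty using (⊥)
open import Data.Product using (Σ; ∃; _×_; _,_; ∃-syntax)
open import Data.Sum using (_⊎_)
open import Relation.Nullary using (¬_)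
open import Relation.Binary.PropositionalEquality using (_≡_; _≢_)

-- A finite simple graph on the vertices v_1,…,v_n, represented by Fin n;
-- the label of a vertex x is toℕ x (so the label order is the order of toℕ).
record Graph (n : ℕ) : Set where
  field
    adj        : Fin n → Fin n → Bool
    adj-sym    : ∀ x y → adj x y ≡ adj y x
    adj-irrefl : ∀ x → adj x x ≡ false

-- Finite vertex subsets (decidable, as all subsets of a finite set are).
VSet : ℕ → Set
VSet n = Fin n → Bool

infix 4 _∈ₛ_
_∈ₛ_ : ∀ {n} → Fin n → VSet n → Set
x ∈ₛ B = B x ≡ true

SameSet : ∀ {n} → (Fin n → Set) → (Fin n → Set) → Set
SameSet P Q = ∀ x → (P x → Q x) × (Q x → P x)

AllV : ∀ {n} → Fin n → Set
AllV _ = ⊤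

module _ {n : ℕ} (G : Graph n) where
  open Graph G

  Adj : Fin n → Fin n → Set
  Adj x y = adj x y ≡ true

  data Walk (S : Fin n → Set) : Fin n → Fin n → ℕ → Set where
    here : ∀ {x} → S x → Walk S x x 0
    step : ∀ {x y z k} → S x → Adj x y → Walk S y z k → Walk S x z (suc k)

  Connected : (Fin n → Set) → Set
  Connected S = ∀ u v → S u → S v → ∃[ k ] Walk S u v k

  Dist : (Fin n → Set) → Fin n → Fin n → ℕ → Set
  Dist S u v k = Walk S u v k × (∀ j → Walk S u v j → k ≤ j)

  Ecc : (Fin n → Set) → Fin n → ℕ → Set
  Ecc S u e = S u
            × (∀ v → S v → ∃[ k ] (Dist S u v k × k ≤ e))
            × (∃[ v ] (S v × Dist S u v e))

  InCenter : (Fin n → Set) → Fin n → Set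
  InCenter S u = ∃[ e ] (Ecc S u e × (∀ w e' → Ecc S w e' → e ≤ e'))

  Diam : (Fin n → Set) → ℕ → Set
  Diam S d = (∃[ u ] Ecc S u d) × (∀ w e → Ecc S w e → e ≤ d)

  IsCutVertex : Fin n → Set
  IsCutVertex v = ∃[ a ] ∃[ b ] (a ≢ v × b ≢ v × ¬ (∃[ k ] Walk (λ x → x ≢ v) a b k))

  NoCutVertex : VSet n → Set
  NoCutVertex B = ∀ v → v ∈ₛ B → Connected (λ x → (x ∈ₛ B) × (x ≢ v))

  -- B is (the vertex set of) a block: a maximal connected subgraph without a cut-vertex.
  -- (Blocks of a simple graph are induced subgraphs, so we range over vertex sets.)
  IsBlock : VSet n → Set
  IsBlock B = Connected (λ x → x ∈ₛ B)
            × NoCutVertex B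
            × (∀ B' → (∀ x → x ∈ₛ B → x ∈ₛ B') → Connected (λ x → x ∈ₛ B')
                    → NoCutVertex B' → ∀ x → x ∈ₛ B' → x ∈ₛ B)

  IsCompleteBipartition : VSet n → VSet n → VSet n → Set
  IsCompleteBipartition B V1 V2 =
      (∀ x → x ∈ₛ B → (x ∈ₛ V1) ⊎ (x ∈ₛ V2))
    × (∀ x → x ∈ₛ V1 → x ∈ₛ B)
    × (∀ x → x ∈ₛ V2 → x ∈ₛ B)
    × (∀ x → x ∈ₛ V1 → x ∈ₛ V2 → ⊥)
    × (∃[ x ] (x ∈ₛ V1))
    × (∃[ x ] (x ∈ₛ V2))
    × (∀ x y → x ∈ₛ V1 → y ∈ₛ V2 → Adj x y)
    × (∀ x y → x ∈ₛ V1 → y ∈ₛ V1 → ¬ Adj x y)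
    × (∀ x y → x ∈ₛ V2 → y ∈ₛ V2 → ¬ Adj x y)

  IsBiBlock : Set
  IsBiBlock = ∀ B → IsBlock B → ∃[ V1 ] ∃[ V2 ] IsCompleteBipartition B V1 V2

  AtMostTwoCutVertices : VSet n → Set
  AtMostTwoCutVertices B =
    ∀ a b c → a ∈ₛ B → b ∈ₛ B → c ∈ₛ B → IsCutVertex a → IsCutVertex b → IsCutVertex c
            → (a ≡ b) ⊎ (a ≡ c) ⊎ (b ≡ c)

  -- G ∈ 𝓑 (connectedness of G is assumed separately)
  InClassB : Set
  InClassB = IsBiBlock
           × (∃[ B ] ∃[ B' ] (IsBlock B × IsBlock B' × ∃[ x ] ((x ∈ₛ B) × ¬ (x ∈ₛ B'))))
           × (∀ B → IsBlock B → AtMostTwoCutVertices B)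

  ExactlyTwoCutIn : VSet n → Set
  ExactlyTwoCutIn V = ∃[ a ] ∃[ b ] (a ≢ b × a ∈ₛ V × b ∈ₛ V × IsCutVertex a × IsCutVertex b
                        × (∀ c → c ∈ₛ V → IsCutVertex c → (c ≡ a) ⊎ (c ≡ b)))

  IsLeafBlock : VSet n → Set
  IsLeafBlock B = ∃[ c ] (c ∈ₛ B × IsCutVertex c × (∀ c' → c' ∈ₛ B → IsCutVertex c' → c' ≡ c))

  MinNonCut : VSet n → Fin n → Set
  MinNonCut V x = x ∈ₛ V × ¬ IsCutVertex x
                × (∀ y → y ∈ₛ V → ¬ IsCutVertex y → toℕ x ≤ toℕ y)

  IsK11 : VSet n → VSet n → Set
  IsK11 V1 V2 = (∀ x y → x ∈ₛ V1 → y ∈ₛ V1 → x ≡ y) × (∀ x y → x ∈ₛ V2 → y ∈ₛ V2 → x ≡ y)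

  InNC : VSet n → VSet n → VSet n → Fin n → Set
  InNC B V1 V2 x =
      (¬ IsK11 V1 V2 ×
         ( (ExactlyTwoCutIn V1 × MinNonCut V2 x)
         ⊎ (ExactlyTwoCutIn V2 × MinNonCut V1 x)
         ⊎ (IsLeafBlock B × (MinNonCut V1 x ⊎ MinNonCut V2 x))))
    ⊎ (IsK11 V1 V2 × (MinNonCut V1 x ⊎ MinNonCut V2 x))

  -- vertex set of T_G :  C_G ∪ ⋃_B NC_B ;  T_G is the subgraph of G induced by it
  InTG : Fin n → Set
  InTG x = IsCutVertex x
         ⊎ (∃[ B ] ∃[ V1 ] ∃[ V2 ] (IsBlock B × IsCompleteBipartition B V1 V2 × InNC B V1 V2 x))

-- If a walk leaves a block B and comes back at another vertex, a simple path along it could be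
-- added to B, against maximality; so every vertex enters B at a unique vertex, which is a
-- cut-vertex when the start lies outside B.  Hence a non-cut-vertex has no neighbours outside
-- the opposite part of its block, and non-cut-vertices in one part are twins.  Every part meets
-- T_G, so moving each vertex to a vertex of T_G in the same part makes T_G a retract, hence
-- isometric in G.  Let r be the radius of T_G.  A vertex of the centre of T_G has eccentricity r
-- in G too, because a vertex missing from T_G is no farther away than some vertex of T_G, unless
-- it is a twin at distance 2 ≤ r.  Conversely let w have eccentricity at most r in G.  If T_G
-- contains w, or a twin of w, that vertex is in the centre of T_G.  Otherwise the block of w has
-- two cut-vertices a and b, with a in the part of w.  Both would lie in the centre of T_G, which
-- forces b into the other part; then the radius is at least 3, and a vertex at distance r from b
-- is at distance at least r + 1 from a or from w.
--
-- Being a cut-vertex, a block or a vertex of T_G is handled in the double-negation monad;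
-- distances are computed by search, and the final claims are decidable.
module Submission where

open import Defs
open import Data.Bool using (Bool; true; false; if_then_else_; _∨_)
open import Data.Bool.Properties using (∨-zeroʳ) renaming (_≟_ to _≟ᵇ_)
open import Data.Empty using (⊥; ⊥-elim)
open import Data.Fin using (Fin; zero; suc; toℕ)
open import Data.Fin.Properties using (_≟_; any?; sequence)
open import Data.List using (List; []; _∷_)
open import Data.List.Membership.Propositional using (_∈_; _∉_)
open import Data.List.Relation.Binary.Subset.Propositional using (_⊆_)
open import Data.List.Relation.Unary.Any using (here; there)
open import Data.Nat using (ℕ; zero; suc; _+_; _≤_; _<_; z≤n; s≤s; _≤?_)
open import Data.Nat.Divisibility using (_∣_; divides)
open import Data.Nat.Properties renaming (_≟_ to _≟ⁿ_)
open import Data.Nat.Tactic.RingSolver using (solve-∀)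
open import Data.Product using (∃; ∃-syntax; _×_; _,_; proj₁; proj₂)
open import Data.Sum using (_⊎_; inj₁; inj₂; swap)
open import Data.Unit using (tt)
open import Effect.Monad using (RawMonad)
open import Function using (_∘_; id)
open import Level using (0ℓ)
open import Relation.Binary.PropositionalEquality
  using (_≡_; _≢_; refl; sym; trans; cong; cong₂; subst; ≢-sym)
open import Relation.Nullary using (¬_; Dec; yes; no; does; ¬?; contradiction; _×-dec_; _⊎-dec_)
open import Relation.Nullary.Decidable using (map′; decidable-stable; ¬¬-excluded-middle; dec-true)
open import Relation.Nullary.Negation using (¬¬-Monad)

open RawMonad (¬¬-Monad {0ℓ}) using (_>>=_; pure; rawApplicative)

-- Double negation and finite search

lem : (P : Set) → ¬ ¬ Dec P
lem P = ¬¬-excluded-middle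

-- The shift is valid because the index set is finite. It lets a predicate such as `T` be taken as
-- decidable on all vertices at once.
∀¬¬⇒¬¬∀ : ∀ {n} {P : Fin n → Set} → (∀ i → ¬ ¬ P i) → ¬ ¬ (∀ i → P i)
∀¬¬⇒¬¬∀ = sequence rawApplicative

≤-¬¬ : ∀ {m n} → ¬ ¬ (m ≤ n) → m ≤ n
≤-¬¬ = decidable-stable (_ ≤? _)

module _ {n : ℕ} where
  open import Data.List.Membership.DecPropositional (_≟_ {n}) public using (_∈?_)

_∈ₛ?_ : ∀ {n} (x : Fin n) (B : VSet n) → Dec (x ∈ₛ B)
x ∈ₛ? B = B x ≟ᵇ true

least : {P : ℕ → Set} → (∀ k → Dec (P k)) → ∀ {k} → P k → ∃[ m ] (P m × (∀ j → P j → m ≤ j))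
least P? {zero} p = 0 , p , λ _ _ → z≤n
least P? {suc k} p with P? 0
... | yes p₀ = 0 , p₀ , λ _ _ → z≤n
... | no ¬p₀ with least (P? ∘ suc) p
...   | m , pm , min = suc m , pm , λ { zero p₀ → contradiction p₀ ¬p₀ ; (suc j) pj → s≤s (min j pj) }

greatest : ∀ {m} {S : Fin m → Set} → (∀ v → Dec (S v)) → {R : Fin m → ℕ → Set} → (∀ v → S v → ∃ (R v))
  → (∀ v → ¬ S v) ⊎ ∃[ e ] ((∀ v → S v → ∃[ k ] (R v k × k ≤ e)) × ∃[ v ] (S v × R v e))
greatest {zero} S? r = inj₁ λ ()
greatest {suc m} S? r with greatest (S? ∘ suc) (λ v → r (suc v)) | S? zero
... | inj₁ none | no ¬s = inj₁ λ { zero → ¬s ; (suc v) → none v }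
... | inj₁ none | yes s =
  let k , rk = r zero s in
  inj₂ (k , (λ { zero _ → k , rk , ≤-refl ; (suc v) sv → contradiction sv (none v) }) , zero , s , rk)
... | inj₂ (e , le , v , sv , rv) | no ¬s =
  inj₂ (e , (λ { zero s → contradiction s ¬s ; (suc w) → le w }) , suc v , sv , rv)
... | inj₂ (e , le , v , sv , rv) | yes s with r zero s
...   | k , rk with ≤-total k e
...     | inj₁ k≤e = inj₂ (e , (λ { zero _ → k , rk , k≤e ; (suc w) → le w }) , suc v , sv , rv)
...     | inj₂ e≤k = inj₂ (k , (λ { zero _ → k , rk , ≤-refl
                                 ; (suc w) sw → let j , rj , j≤e = le w sw in j , rj , ≤-trans j≤e e≤k })
                          , zero , s , rk)

∃-minimal : ∀ {n} {P : Fin n → Set} {x} → P x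
  → ¬ ¬ (∃[ y ] (P y × (∀ z → P z → toℕ y ≤ toℕ z)))
∃-minimal {P = P} {x} px = do
    P? ← ∀¬¬⇒¬¬∀ (λ y → lem (P y))
    (_ , (y , py , refl) , min) ← pure (least {λ k → ∃[ y ] (P y × toℕ y ≡ k)}
                                          (λ k → any? (λ y → P? y ×-dec toℕ y ≟ⁿ k)) (x , px , refl))
    pure (y , py , λ z pz → min _ (z , pz , refl))

-- Walks, simple paths and entries into a vertex set

module Walks {n : ℕ} (G : Graph n) where
  open Graph G

  ~sym : ∀ {x y} → Adj G x y → Adj G y x
  ~sym {x} {y} e = trans (adj-sym y x) e

  ~⇒≢ : ∀ {x y} → Adj G x y → x ≢ y
  ~⇒≢ {x} e refl with trans (sym e) (adj-irrefl x)
  ... | ()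

  _~?_ : ∀ x y → Dec (Adj G x y)
  x ~? y = adj x y ≟ᵇ true

  source∈ : ∀ {S x y k} → Walk G S x y k → S x
  source∈ (here s) = s
  source∈ (step s _ _) = s

  map-walk : ∀ {S S' : Fin n → Set} → (∀ {x} → S x → S' x) → ∀ {x y k} → Walk G S x y k → Walk G S' x y k
  map-walk f (here s) = here (f s)
  map-walk f (step s e w) = step (f s) e (map-walk f w)

  forget : ∀ {S x y k} → Walk G S x y k → Walk G AllV x y k
  forget = map-walk (λ _ → tt)

  _++ʷ_ : ∀ {S x y z k l} → Walk G S x y k → Walk G S y z l → Walk G S x z (k + l)
  here _ ++ʷ w = w
  step s e v ++ʷ w = step s e (v ++ʷ w)

  snoc : ∀ {S x y z k} → Walk G S x y k → Adj G y z → S z → Walk G S x z (suc k)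
  snoc (here s) e sz = step s e (here sz)
  snoc (step s e w) e' sz = step s e (snoc w e' sz)

  reverse : ∀ {S x y k} → Walk G S x y k → Walk G S y x k
  reverse (here s) = here s
  reverse (step s e w) = snoc (reverse w) (~sym e) s

  walk? : ∀ {S} → (∀ x → Dec (S x)) → ∀ k x y → Dec (Walk G S x y k)
  walk? S? zero x y = map′ (λ { (refl , s) → here s }) (λ { (here s) → refl , s }) ((x ≟ y) ×-dec S? x)
  walk? S? (suc k) x y =
    map′ (λ { (s , _ , e , w) → step s e w }) (λ { (step s e w) → s , _ , e , w })
         (S? x ×-dec any? (λ u → (x ~? u) ×-dec walk? S? k u y))

  distance : ∀ {S} → (∀ x → Dec (S x)) → Connected G S → ∀ x y → S x → S y → ∃ (Dist G S x y)
  distance S? conn x y sx sy = least (λ k → walk? S? k x y) (proj₂ (conn x y sx sy))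

  eccentricity : ∀ {S} → (∀ x → Dec (S x)) → Connected G S → ∀ x → S x → ∃ (Ecc G S x)
  eccentricity {S} S? conn x sx with greatest {S = S} S? {Dist G S x} (λ v → distance S? conn x v sx)
  ... | inj₁ none = contradiction sx (none x)
  ... | inj₂ (e , le , v , sv , dv) = e , sx , le , v , sv , dv

  data SimplePath : Fin n → Fin n → List (Fin n) → Set where
    [_]    : ∀ a → SimplePath a a (a ∷ [])
    _∷⟨_⟩_ : ∀ {a b c L} → a ∉ L → Adj G a b → SimplePath b c L → SimplePath a c (a ∷ L)

  start∈ : ∀ {a c L} → SimplePath a c L → a ∈ L
  start∈ [ a ] = here refl
  start∈ (_ ∷⟨ _ ⟩ _) = here refl

  suffix : ∀ {a b c L} → SimplePath b c L → a ∈ L → ∃[ L' ] (SimplePath a c L' × L' ⊆ L)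
  suffix p@([ _ ]) (here refl) = _ , p , id
  suffix p@(_ ∷⟨ _ ⟩ _) (here refl) = _ , p , id
  suffix (_ ∷⟨ _ ⟩ p) (there i) = let L' , q , sub = suffix p i in L' , q , there ∘ sub

  walk⇒simplePath : ∀ {S a c k} → Walk G S a c k
    → ∃[ L ] (SimplePath a c L × (∀ {x} → x ∈ L → S x))
  walk⇒simplePath (here s) = _ , [ _ ] , λ { (here refl) → s }
  walk⇒simplePath (step {x} s e w) with walk⇒simplePath w
  ... | L , p , all with x ∈? L
  ...   | yes x∈ = let L' , q , sub = suffix p x∈ in L' , q , all ∘ sub
  ...   | no x∉ = _ , x∉ ∷⟨ e ⟩ p , λ { (here refl) → s ; (there i) → all i }

  path-to-start : ∀ {a c L w} → SimplePath a c L → w ∈ L → ∃ (Walk G (_∈ L) w a)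
  path-to-start [ _ ] (here refl) = _ , here (here refl)
  path-to-start (_ ∷⟨ _ ⟩ _) (here refl) = _ , here (here refl)
  path-to-start (_ ∷⟨ e ⟩ p) (there i) =
    let _ , u = path-to-start p i in _ , snoc (map-walk there u) (~sym e) (here refl)

  path-to-end : ∀ {a c L w} → SimplePath a c L → w ∈ L → ∃ (Walk G (_∈ L) w c)
  path-to-end [ _ ] (here refl) = _ , here (here refl)
  path-to-end (_ ∷⟨ e ⟩ p) (here refl) =
    let _ , u = path-to-end p (start∈ p) in _ , step (here refl) e (map-walk there u)
  path-to-end (_ ∷⟨ _ ⟩ p) (there i) = let _ , u = path-to-end p i in _ , map-walk there u

  -- Deleting `v` leaves at most two pieces of the path, each containing an end. Simplicity enters
  -- when `v` is the head: the rest of the path then avoids it.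
  path-minus-vertex : ∀ {a c L w} v → SimplePath a c L → w ∈ L → w ≢ v
    → ∃ (Walk G (λ x → x ∈ L × x ≢ v) w a) ⊎ ∃ (Walk G (λ x → x ∈ L × x ≢ v) w c)
  path-minus-vertex v [ _ ] (here refl) w≢v = inj₁ (_ , here (here refl , w≢v))
  path-minus-vertex v (_ ∷⟨ _ ⟩ _) (here refl) w≢v = inj₁ (_ , here (here refl , w≢v))
  path-minus-vertex v (_∷⟨_⟩_ {a = a} a∉ e p) (there i) w≢v with path-minus-vertex v p i w≢v | a ≟ v
  ... | inj₂ (_ , u) | _ = inj₂ (_ , map-walk (λ (x∈ , x≢) → there x∈ , x≢) u)
  ... | inj₁ (_ , u) | no a≢v =
        inj₁ (_ , snoc (map-walk (λ (x∈ , x≢) → there x∈ , x≢) u) (~sym e) (here refl , a≢v))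
  ... | inj₁ _ | yes refl =
        let _ , u = path-to-end p i in inj₂ (_ , map-walk (λ x∈ → there x∈ , λ { refl → a∉ x∈ }) u)

  connected-extend : ∀ {S S' : Fin n → Set} → (∀ {x} → S x → S' x) → Connected G S
    → (∀ {x} → S' x → ∃[ y ] (S y × ∃ (Walk G S' x y))) → Connected G S'
  connected-extend sub conn reach u v su sv =
    let x , sx , _ , p = reach su
        y , sy , _ , q = reach sv
        _ , w = conn x y sx sy
    in _ , p ++ʷ (map-walk sub w ++ʷ reverse q)

  -- The walk in AllV from x to g whose only vertex in B is g.
  data Enters (B : VSet n) : Fin n → Fin n → ℕ → Set where
    at   : ∀ {x} → x ∈ₛ B → Enters B x x 0
    from : ∀ {x y g k} → ¬ x ∈ₛ B → Adj G x y → Enters B y g k → Enters B x g (suc k)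

  entry∈ : ∀ {B x g k} → Enters B x g k → g ∈ₛ B
  entry∈ (at b) = b
  entry∈ (from _ _ h) = entry∈ h

  enters-member : ∀ {B x g k} → x ∈ₛ B → Enters B x g k → x ≡ g
  enters-member b (at _) = refl
  enters-member b (from ¬b _ _) = contradiction b ¬b

  enters⇒walk : ∀ {B S} → (∀ {x} → ¬ x ∈ₛ B → S x) → ∀ {x g k} → S g → Enters B x g k → Walk G S x g k
  enters⇒walk f sg (at _) = here sg
  enters⇒walk f sg (from ¬b e h) = step (f ¬b) e (enters⇒walk f sg h)

  before-entry : ∀ {B x g k} → ¬ x ∈ₛ B → Enters B x g k
    → ∃[ y ] ∃[ l ] (Walk G (λ u → ¬ u ∈ₛ B) x y l × Adj G y g)
  before-entry x∉ (at x∈) = contradiction x∈ x∉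
  before-entry x∉ (from _ e (at _)) = _ , _ , here x∉ , e
  before-entry x∉ (from _ e h@(from y∉ _ _)) =
    let y , l , w , e' = before-entry y∉ h in y , suc l , step x∉ e w , e'

  first-entry : ∀ {S B x y m} → Walk G S x y m → y ∈ₛ B
    → ∃[ g ] ∃[ k ] ∃[ l ] (Enters B x g k × Walk G S g y l × k + l ≡ m)
  first-entry (here s) b = _ , _ , _ , at b , here s , refl
  first-entry {B = B} (step {x} s e w) b with x ∈ₛ? B
  ... | yes x∈ = _ , _ , _ , at x∈ , step s e w , refl
  ... | no x∉ = let g , k , l , h , w' , eq = first-entry w b in g , suc k , l , from x∉ e h , w' , cong suc eq

  -- A walk that stays outside `B` before its last vertex can be prepended to the entry of that
  -- vertex, so its start also enters at `h`. Otherwise the walk is split at a vertex of `B`.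
  meets-or-avoids : ∀ {S B x y h m j} → Walk G S x y m → Enters B y h j
    → (∃ (Enters B x h)) ⊎ ∃[ p ] ∃[ k ] ∃[ l ] (p ∈ₛ B × Walk G S x p k × Walk G S p y l × k + l ≡ m)
  meets-or-avoids (here _) hy = inj₁ (_ , hy)
  meets-or-avoids {B = B} (step {x} s e w) hy with x ∈ₛ? B | meets-or-avoids w hy
  ... | yes x∈ | _ = inj₂ (_ , _ , _ , x∈ , here s , step s e w , refl)
  ... | no x∉ | inj₁ (_ , h) = inj₁ (_ , from x∉ e h)
  ... | no _ | inj₂ (p , _ , _ , p∈ , w₁ , w₂ , eq) = inj₂ (p , _ , _ , p∈ , step s e w₁ , w₂ , cong suc eq)

-- Sizes and extensions of vertex sets

∣_∣ₛ : ∀ {n} → VSet n → ℕ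
∣_∣ₛ {zero} B = 0
∣_∣ₛ {suc n} B = (if B zero then 1 else 0) + ∣ B ∘ suc ∣ₛ

∣∣ₛ≤n : ∀ {n} (B : VSet n) → ∣ B ∣ₛ ≤ n
∣∣ₛ≤n {zero} B = z≤n
∣∣ₛ≤n {suc n} B with B zero
... | true = s≤s (∣∣ₛ≤n (B ∘ suc))
... | false = m≤n⇒m≤1+n (∣∣ₛ≤n (B ∘ suc))

indicator-mono : ∀ b c → (b ≡ true → c ≡ true) → (if b then 1 else 0) ≤ (if c then 1 else 0)
indicator-mono false _ _ = z≤n
indicator-mono true true _ = ≤-refl
indicator-mono true false f with f refl
... | ()

∣∣ₛ-mono-≤ : ∀ {n} (B C : VSet n) → (∀ x → x ∈ₛ B → x ∈ₛ C) → ∣ B ∣ₛ ≤ ∣ C ∣ₛ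
∣∣ₛ-mono-≤ {zero} B C sub = z≤n
∣∣ₛ-mono-≤ {suc n} B C sub = +-mono-≤ (indicator-mono (B zero) (C zero) (sub zero)) (∣∣ₛ-mono-≤ _ _ (sub ∘ suc))

∣∣ₛ-mono-< : ∀ {n} (B C : VSet n) → (∀ x → x ∈ₛ B → x ∈ₛ C) → ∀ {x} → x ∈ₛ C → ¬ x ∈ₛ B → ∣ B ∣ₛ < ∣ C ∣ₛ
∣∣ₛ-mono-< {suc n} B C sub {zero} x∈ x∉ with B zero | C zero
... | true | _ = contradiction refl x∉
... | false | true = s≤s (∣∣ₛ-mono-≤ _ _ (sub ∘ suc))
∣∣ₛ-mono-< {suc n} B C sub {suc x} x∈ x∉ =
  subst (_≤ ∣ C ∣ₛ) (+-suc _ _) (+-mono-≤ (indicator-mono (B zero) (C zero) (sub zero)) (∣∣ₛ-mono-< _ _ (sub ∘ suc) x∈ x∉))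

_∪ˡ_ : ∀ {n} → VSet n → List (Fin n) → VSet n
(B ∪ˡ L) x = B x ∨ does (x ∈? L)

∪ˡ⁺ˡ : ∀ {n} (B : VSet n) L {x} → x ∈ₛ B → x ∈ₛ (B ∪ˡ L)
∪ˡ⁺ˡ B L x∈ rewrite x∈ = refl

∪ˡ⁺ʳ : ∀ {n} (B : VSet n) L {x} → x ∈ L → x ∈ₛ (B ∪ˡ L)
∪ˡ⁺ʳ B L {x} x∈ rewrite dec-true (x ∈? L) x∈ = ∨-zeroʳ (B x)

∪ˡ⁻ : ∀ {n} (B : VSet n) L {x} → x ∈ₛ (B ∪ˡ L) → x ∈ₛ B ⊎ x ∈ L
∪ˡ⁻ B L {x} p with B x | x ∈? L
... | true | _ = inj₁ refl
... | false | yes x∈ = inj₂ x∈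

-- Blocks: ears, unique entries, maximality

module Blocks {n : ℕ} (G : Graph n) where
  open Walks G public

  -- `L` is an ear, attached to `B` at two different feet `g` and `h`. Adding it keeps the set
  -- connected and free of cut-vertices, so maximality would pull `a` into `B`.
  no-ear : ∀ {B a c L g h} → IsBlock G B → SimplePath a c L → (∀ {x} → x ∈ L → ¬ x ∈ₛ B)
    → g ∈ₛ B → h ∈ₛ B → Adj G a g → Adj G c h → g ≢ h → ⊥
  no-ear {B} {a} {c} {L} {g} {h} (conn , nocut , maximal) p out g∈ h∈ a~g c~h g≢h =
    out (start∈ p) (maximal C (λ _ → left) conn' nocut' a (right (start∈ p)))
    where
    C = B ∪ˡ L

    left : ∀ {x} → x ∈ₛ B → x ∈ₛ C
    left = ∪ˡ⁺ˡ B L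

    right : ∀ {x} → x ∈ L → x ∈ₛ C
    right = ∪ˡ⁺ʳ B L

    conn' : Connected G (_∈ₛ C)
    conn' = connected-extend left conn λ x∈C → case-reach (∪ˡ⁻ B L x∈C)
      where
      case-reach : ∀ {x} → x ∈ₛ B ⊎ x ∈ L → ∃[ y ] (y ∈ₛ B × ∃ (Walk G (_∈ₛ C) x y))
      case-reach (inj₁ x∈B) = _ , x∈B , _ , here (left x∈B)
      case-reach (inj₂ x∈L) =
        let _ , w = path-to-start p x∈L in g , g∈ , _ , snoc (map-walk right w) a~g (left g∈)

    nocut' : NoCutVertex G C
    nocut' v v∈C = connected-extend {λ x → x ∈ₛ B × x ≢ v} {λ x → x ∈ₛ C × x ≢ v} (λ (x∈ , x≢) → left x∈ , x≢)
                     conn-v (λ (x∈C , x≢v) → reach (∪ˡ⁻ B L x∈C) x≢v)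
      where
      conn-v : Connected G (λ x → x ∈ₛ B × x ≢ v)
      conn-v with v ∈ₛ? B
      ... | yes v∈ = nocut v v∈
      ... | no v∉ = λ u w (u∈ , _) (w∈ , _) →
        let _ , q = conn u w u∈ w∈ in _ , map-walk (λ x∈ → x∈ , λ { refl → v∉ x∈ }) q

      to-g : g ≢ v → ∀ {x} → ∃ (Walk G (λ x → x ∈ L × x ≢ v) x a)
        → ∃[ y ] ((y ∈ₛ B × y ≢ v) × ∃ (Walk G (λ x → x ∈ₛ C × x ≢ v) x y))
      to-g g≢v (_ , w) = g , (g∈ , g≢v) , _ , snoc (map-walk (λ (x∈ , x≢) → right x∈ , x≢) w) a~g (left g∈ , g≢v)

      to-h : h ≢ v → ∀ {x} → ∃ (Walk G (λ x → x ∈ L × x ≢ v) x c)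
        → ∃[ y ] ((y ∈ₛ B × y ≢ v) × ∃ (Walk G (λ x → x ∈ₛ C × x ≢ v) x y))
      to-h h≢v (_ , w) = h , (h∈ , h≢v) , _ , snoc (map-walk (λ (x∈ , x≢) → right x∈ , x≢) w) c~h (left h∈ , h≢v)

      reach : ∀ {x} → x ∈ₛ B ⊎ x ∈ L → x ≢ v
        → ∃[ y ] ((y ∈ₛ B × y ≢ v) × ∃ (Walk G (λ x → x ∈ₛ C × x ≢ v) x y))
      reach (inj₁ x∈B) x≢v = _ , (x∈B , x≢v) , _ , here (left x∈B , x≢v)
      reach (inj₂ x∈L) x≢v with path-minus-vertex v p x∈L x≢v | g ≟ v | h ≟ v
      ... | inj₁ w | no g≢v | _ = to-g g≢v w
      ... | inj₂ w | _ | no h≢v = to-h h≢v w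
      -- The foot `g` is the deleted vertex. It lies in `B`, so the whole ear survives and leads to
      -- `h` instead.
      ... | inj₁ _ | yes refl | _ =
            let _ , w = path-to-end p x∈L
            in to-h (g≢h ∘ sym) (_ , map-walk (λ y∈ → y∈ , λ { refl → out y∈ g∈ }) w)
      ... | inj₂ _ | _ | yes refl =
            let _ , w = path-to-start p x∈L
            in to-g g≢h (_ , map-walk (λ y∈ → y∈ , λ { refl → out y∈ h∈ }) w)

  -- Two walks to different entries, joined outside `B` and shortened to a simple path, would form
  -- an ear with feet `g` and `h`.
  entry-unique : ∀ {B x g h k l} → IsBlock G B → Enters B x g k → Enters B x h l → g ≡ h
  entry-unique blk (at x∈) eh = enters-member x∈ eh
  entry-unique {g = g} {h} blk eg@(from x∉ _ _) eh with g ≟ h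
  ... | yes g≡h = g≡h
  ... | no g≢h =
    let _ , _ , wa , a~g = before-entry x∉ eg
        _ , _ , wc , c~h = before-entry x∉ eh
        _ , p , out = walk⇒simplePath (reverse wa ++ʷ wc)
    in ⊥-elim (no-ear blk p out (entry∈ eg) (entry∈ eh) a~g c~h g≢h)

  -- A vertex `x` of `C` outside `B` would enter `B` at some `g`. One of `p`, `q` differs from `g`,
  -- and `C` without `g` still joins `x` to it, which gives `x` a second entry.
  shared-pair⇒⊆ : ∀ {B C p q} → IsBlock G B → IsBlock G C → p ≢ q → p ∈ₛ B → q ∈ₛ B → p ∈ₛ C → q ∈ₛ C
    → ∀ {x} → x ∈ₛ C → x ∈ₛ B
  shared-pair⇒⊆ {B} {C} {p} {q} blkB blkC p≢q p∈B q∈B p∈C q∈C {x} x∈C with x ∈ₛ? B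
  ... | yes x∈B = x∈B
  ... | no x∉B =
    let g , _ , _ , eg , _ = first-entry (proj₂ (proj₁ blkC x p x∈C p∈C)) p∈B
    in ⊥-elim (avoid eg)
    where
    via : ∀ {g k} → Enters B x g k → g ∈ₛ C → ∀ y → y ∈ₛ B → y ∈ₛ C → y ≢ g → ⊥
    via eg g∈C y y∈B y∈C y≢g =
      let _ , w = proj₁ (proj₂ blkC) _ g∈C x y (x∈C , λ { refl → x∉B (entry∈ eg) }) (y∈C , y≢g)
          _ , _ , _ , eh , u , _ = first-entry w y∈B
      in proj₂ (source∈ u) (entry-unique blkB eh eg)

    avoid : ∀ {g k} → Enters B x g k → ⊥
    avoid {g} eg with p ≟ g
    ... | yes refl = via eg p∈C q q∈B q∈C (≢-sym p≢q)
    -- Deleting `g` from `C` requires `g` in `C`: a walk inside `C` from `x` to `p` first meets `B`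
    -- at a vertex of `C`, which is `g` by uniqueness.
    ... | no p≢g =
      let _ , _ , _ , eh , u , _ = first-entry (proj₂ (proj₁ blkC x p x∈C p∈C)) p∈B
      in via eg (subst (_∈ₛ C) (entry-unique blkB eh eg) (source∈ u)) p p∈B p∈C p≢g

  -- If no block lay above `B`, then `B` would itself be maximal, because a properly larger
  -- candidate `C` has a block above it by induction. The fuel `k` bounds the number of vertices
  -- still missing.
  block-above : ∀ B → Connected G (_∈ₛ B) → NoCutVertex G B → ¬ ¬ (∃[ C ] (IsBlock G C × (∀ x → x ∈ₛ B → x ∈ₛ C)))
  block-above B = go n B (m≤m+n n _)
    where
    go : ∀ k B → n ≤ k + ∣ B ∣ₛ → Connected G (_∈ₛ B) → NoCutVertex G B
      → ¬ ¬ (∃[ C ] (IsBlock G C × (∀ x → x ∈ₛ B → x ∈ₛ C)))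
    go k B bound conn nocut none = none (B , (conn , nocut , maximal k bound) , λ _ → id)
      where
      maximal : ∀ k → n ≤ k + ∣ B ∣ₛ → ∀ C → (∀ x → x ∈ₛ B → x ∈ₛ C) → Connected G (_∈ₛ C) → NoCutVertex G C
        → ∀ x → x ∈ₛ C → x ∈ₛ B
      maximal k bound C B⊆C connC nocutC x x∈C with x ∈ₛ? B
      ... | yes x∈B = x∈B
      maximal zero bound C B⊆C connC nocutC x x∈C | no x∉B =
        ⊥-elim (<⇒≱ (∣∣ₛ-mono-< B C B⊆C x∈C x∉B) (≤-trans (∣∣ₛ≤n C) bound))
      maximal (suc k) bound C B⊆C connC nocutC x x∈C | no x∉B =
        ⊥-elim (go k C (≤-trans bound (≤-trans (≤-reflexive (sym (+-suc k _)))
                                               (+-monoʳ-≤ k (∣∣ₛ-mono-< B C B⊆C x∈C x∉B))))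
                   connC nocutC (λ (D , blk , C⊆D) → none (D , blk , λ y → C⊆D y ∘ B⊆C y)))

  edge-in-block : ∀ {u v} → Adj G u v → ¬ ¬ (∃[ B ] (IsBlock G B × u ∈ₛ B × v ∈ₛ B))
  edge-in-block {u} {v} u~v = do
      C , blk , sub ← block-above E conn nocut
      pure (C , blk , sub u u∈ , sub v v∈)
    where
    E : VSet n
    E = (λ _ → false) ∪ˡ (u ∷ v ∷ [])

    u∈ : u ∈ₛ E
    u∈ = ∪ˡ⁺ʳ (λ _ → false) (u ∷ v ∷ []) (here refl)

    v∈ : v ∈ₛ E
    v∈ = ∪ˡ⁺ʳ (λ _ → false) (u ∷ v ∷ []) (there (here refl))

    E⁻ : ∀ {x} → x ∈ₛ E → x ≡ u ⊎ x ≡ v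
    E⁻ p with ∪ˡ⁻ (λ _ → false) (u ∷ v ∷ []) p
    ... | inj₂ (here x≡u) = inj₁ x≡u
    ... | inj₂ (there (here x≡v)) = inj₂ x≡v

    conn : Connected G (_∈ₛ E)
    conn a b a∈ b∈ with E⁻ {a} a∈ | E⁻ {b} b∈
    ... | inj₁ refl | inj₁ refl = _ , here a∈
    ... | inj₁ refl | inj₂ refl = _ , step a∈ u~v (here b∈)
    ... | inj₂ refl | inj₁ refl = _ , step a∈ (~sym u~v) (here b∈)
    ... | inj₂ refl | inj₂ refl = _ , here a∈

    nocut : NoCutVertex G E
    nocut w w∈ a b (a∈ , a≢w) (b∈ , b≢w) with E⁻ {w} w∈ | E⁻ {a} a∈ | E⁻ {b} b∈
    ... | _ | inj₁ refl | inj₁ refl = _ , here (a∈ , a≢w)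
    ... | _ | inj₂ refl | inj₂ refl = _ , here (a∈ , a≢w)
    ... | inj₁ refl | inj₁ refl | inj₂ _ = contradiction refl a≢w
    ... | inj₁ refl | inj₂ _ | inj₁ refl = contradiction refl b≢w
    ... | inj₂ refl | inj₁ _ | inj₂ refl = contradiction refl b≢w
    ... | inj₂ refl | inj₂ refl | inj₁ _ = contradiction refl a≢w

-- Distances through a block

module Metric {n : ℕ} (G : Graph n) (conn : Connected G AllV) where
  open Blocks G public

  private
    all-distances : ∀ x y → ∃ (Dist G AllV x y)
    all-distances x y = distance (λ _ → yes tt) conn x y tt tt

  dist : Fin n → Fin n → ℕ
  dist x y = proj₁ (all-distances x y)

  geodesic : ∀ x y → Walk G AllV x y (dist x y)
  geodesic x y = proj₁ (proj₂ (all-distances x y))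

  dist-min : ∀ {x y k} → Walk G AllV x y k → dist x y ≤ k
  dist-min = proj₂ (proj₂ (all-distances _ _)) _

  Dist⇒≡dist : ∀ {x y k} → Dist G AllV x y k → k ≡ dist x y
  Dist⇒≡dist {x} {y} (w , min) = ≤-antisym (min _ (geodesic x y)) (dist-min w)

  dist-sym : ∀ x y → dist x y ≡ dist y x
  dist-sym x y = ≤-antisym (dist-min (reverse (geodesic y x))) (dist-min (reverse (geodesic x y)))

  dist-triangle : ∀ x y z → dist x z ≤ dist x y + dist y z
  dist-triangle x y z = dist-min (geodesic x y ++ʷ geodesic y z)

  adj⇒dist≤1 : ∀ {x y} → Adj G x y → dist x y ≤ 1
  adj⇒dist≤1 e = dist-min (step tt e (here tt))

  dist-self : ∀ x → dist x x ≤ 0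
  dist-self x = dist-min (here tt)

  ≢⇒1≤dist : ∀ {x y} → x ≢ y → 1 ≤ dist x y
  ≢⇒1≤dist {x} {y} x≢y with dist x y | geodesic x y
  ... | _ | here _ = contradiction refl x≢y
  ... | _ | step _ _ _ = s≤s z≤n

  non-adj⇒2≤dist : ∀ {x y} → x ≢ y → ¬ Adj G x y → 2 ≤ dist x y
  non-adj⇒2≤dist {x} {y} x≢y x≁y with dist x y | geodesic x y
  ... | _ | here _ = contradiction refl x≢y
  ... | _ | step _ e (here _) = contradiction e x≁y
  ... | _ | step _ _ (step _ _ _) = s≤s (s≤s z≤n)

  entry-of : ∀ {B y} → y ∈ₛ B → ∀ x → ∃[ g ] ∃ (Enters B x g)
  entry-of y∈ x = let g , k , _ , h , _ = first-entry (geodesic x _) y∈ in g , k , h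

  -- A shortest walk into the block first meets it at `g`, since entries are unique, and is cut
  -- there.
  dist-via-entry : ∀ {B x g k y} → IsBlock G B → Enters B x g k → y ∈ₛ B → dist x g + dist g y ≤ dist x y
  dist-via-entry {x = x} {y = y} blk eg y∈ with first-entry (geodesic x y) y∈
  ... | h , k , l , eh , w , eq with entry-unique blk eg eh
  ...   | refl = ≤-trans (+-mono-≤ (dist-min (enters⇒walk (λ _ → tt) tt eh)) (dist-min w)) (≤-reflexive eq)

  -- A geodesic from `x` to `y` has to meet the block, else `x` would enter at `h` too. At a common
  -- vertex `p` both halves are bounded by `dist-via-entry`, and the triangle through `p` supplies
  -- `dist g h`.
  dist-via-entries : ∀ {B x y g h k l} → IsBlock G B → Enters B x g k → Enters B y h l → g ≢ h
    → dist x g + dist g h + dist h y ≤ dist x y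
  dist-via-entries {x = x} {y} {g} {h} blk eg eh g≢h with meets-or-avoids (geodesic x y) eh
  ... | inj₁ (_ , eh') = contradiction (entry-unique blk eg eh') g≢h
  ... | inj₂ (p , k , l , p∈ , w₁ , w₂ , eq) = begin
      dist x g + dist g h + dist h y
        ≤⟨ +-monoˡ-≤ _ (+-monoʳ-≤ (dist x g) (dist-triangle g p h)) ⟩
      dist x g + (dist g p + dist p h) + dist h y
        ≡⟨ rearrange (dist x g) (dist g p) (dist p h) (dist h y) ⟩
      (dist x g + dist g p) + (dist h y + dist p h)
        ≡⟨ cong ((dist x g + dist g p) +_) (cong₂ _+_ (dist-sym h y) (dist-sym p h)) ⟩
      (dist x g + dist g p) + (dist y h + dist h p)
        ≤⟨ +-mono-≤ (dist-via-entry blk eg p∈) (dist-via-entry blk eh p∈) ⟩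
      dist x p + dist y p
        ≤⟨ +-mono-≤ (dist-min w₁) (dist-min (reverse w₂)) ⟩
      k + l
        ≡⟨ eq ⟩
      dist x y ∎
    where
    open ≤-Reasoning
    rearrange : ∀ a b c d → a + (b + c) + d ≡ (a + b) + (d + c)
    rearrange = solve-∀

-- Parts of blocks, cut-vertices and representatives in `T`

module BiBlock {n : ℕ} (G : Graph n) (conn : Connected G AllV) (cls : InClassB G) where
  open Metric G conn public

  Cut T : Fin n → Set
  Cut = IsCutVertex G
  T = InTG G

  ∉T⇒¬cut : ∀ {x} → ¬ T x → ¬ Cut x
  ∉T⇒¬cut x∉ c = x∉ (inj₁ c)

  -- V and W are, in this order, the two parts of a block.
  record Parts (V W : VSet n) : Set where
    field
      {body}      : VSet n
      block       : IsBlock G body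
      bipartition : IsCompleteBipartition G body V W

    cover : ∀ {x} → x ∈ₛ body → x ∈ₛ V ⊎ x ∈ₛ W
    cover = proj₁ bipartition _

    left : ∀ {x} → x ∈ₛ V → x ∈ₛ body
    left = proj₁ (proj₂ bipartition) _

    right : ∀ {x} → x ∈ₛ W → x ∈ₛ body
    right = proj₁ (proj₂ (proj₂ bipartition)) _

    disjoint : ∀ {x} → x ∈ₛ V → x ∈ₛ W → ⊥
    disjoint = proj₁ (proj₂ (proj₂ (proj₂ bipartition))) _

    left-inhabited : ∃ (_∈ₛ V)
    left-inhabited = proj₁ (proj₂ (proj₂ (proj₂ (proj₂ bipartition))))

    right-inhabited : ∃ (_∈ₛ W)
    right-inhabited = proj₁ (proj₂ (proj₂ (proj₂ (proj₂ (proj₂ bipartition)))))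

    cross : ∀ {x y} → x ∈ₛ V → y ∈ₛ W → Adj G x y
    cross = proj₁ (proj₂ (proj₂ (proj₂ (proj₂ (proj₂ (proj₂ bipartition)))))) _ _

    left-indep : ∀ {x y} → x ∈ₛ V → y ∈ₛ V → ¬ Adj G x y
    left-indep = proj₁ (proj₂ (proj₂ (proj₂ (proj₂ (proj₂ (proj₂ (proj₂ bipartition))))))) _ _

    right-indep : ∀ {x y} → x ∈ₛ W → y ∈ₛ W → ¬ Adj G x y
    right-indep = proj₂ (proj₂ (proj₂ (proj₂ (proj₂ (proj₂ (proj₂ (proj₂ bipartition))))))) _ _

  open Parts

  flip : ∀ {V W} → Parts V W → Parts W V
  flip K = record
    { block = block K
    ; bipartition = (λ _ → swap ∘ cover K) , (λ _ → right K) , (λ _ → left K) , (λ _ x∈W x∈V → disjoint K x∈V x∈W)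
                  , right-inhabited K , left-inhabited K , (λ _ _ x∈W y∈V → ~sym (cross K y∈V x∈W))
                  , (λ _ _ → right-indep K) , (λ _ _ → left-indep K)
    }

  left-dist≤2 : ∀ {V W x y} → Parts V W → x ∈ₛ V → y ∈ₛ V → dist x y ≤ 2
  left-dist≤2 K x∈ y∈ =
    let _ , u∈ = right-inhabited K in dist-min (step tt (cross K x∈ u∈) (step tt (~sym (cross K y∈ u∈)) (here tt)))

  left≢⇒2≤dist : ∀ {V W x y} → Parts V W → x ∈ₛ V → y ∈ₛ V → x ≢ y → 2 ≤ dist x y
  left≢⇒2≤dist K x∈ y∈ x≢y = non-adj⇒2≤dist x≢y (left-indep K x∈ y∈)

  block-dist≤2 : ∀ {V W x y} (K : Parts V W) → x ∈ₛ body K → y ∈ₛ body K → dist x y ≤ 2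
  block-dist≤2 K x∈ y∈ with cover K x∈ | cover K y∈
  ... | inj₁ x∈V | inj₁ y∈V = left-dist≤2 K x∈V y∈V
  ... | inj₁ x∈V | inj₂ y∈W = m≤n⇒m≤1+n (adj⇒dist≤1 (cross K x∈V y∈W))
  ... | inj₂ x∈W | inj₁ y∈V = m≤n⇒m≤1+n (adj⇒dist≤1 (~sym (cross K y∈V x∈W)))
  ... | inj₂ x∈W | inj₂ y∈W = left-dist≤2 (flip K) x∈W y∈W

  edge-parts : ∀ {x y} → Adj G x y → ¬ ¬ (∃[ V ] ∃[ W ] (Parts V W × x ∈ₛ V × y ∈ₛ W))
  edge-parts {x} {y} x~y = do
    B , blk , x∈ , y∈ ← edge-in-block x~y
    let V , W , bip = proj₁ cls B blk
        K : Parts V W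
        K = record { block = blk ; bipartition = bip }
    pure (orient K (cover K x∈) (cover K y∈))
    where
    orient : ∀ {V W} → Parts V W → x ∈ₛ V ⊎ x ∈ₛ W → y ∈ₛ V ⊎ y ∈ₛ W
      → ∃[ V ] ∃[ W ] (Parts V W × x ∈ₛ V × y ∈ₛ W)
    orient K (inj₁ x∈) (inj₂ y∈) = _ , _ , K , x∈ , y∈
    orient K (inj₂ x∈) (inj₁ y∈) = _ , _ , flip K , x∈ , y∈
    orient K (inj₁ x∈) (inj₁ y∈) = ⊥-elim (left-indep K x∈ y∈ x~y)
    orient K (inj₂ x∈) (inj₂ y∈) = ⊥-elim (right-indep K x∈ y∈ x~y)

  -- `g` separates `x` from any other vertex of the block, since a walk avoiding `g` would enter
  -- elsewhere. Such a vertex exists because the part opposite to `g` is inhabited.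
  entry-is-cut : ∀ {V W x g k} (K : Parts V W) → ¬ x ∈ₛ body K → Enters (body K) x g k → Cut g
  entry-is-cut {V} {W} {x} {g} K x∉ eg = x , proj₁ other , (λ { refl → x∉ (entry∈ eg) }) , proj₂ (proj₂ other) ,
      λ (_ , w) → let _ , _ , _ , eh , u , _ = first-entry w (proj₁ (proj₂ other))
                  in source∈ u (entry-unique (block K) eh eg)
    where
    other : ∃[ b ] (b ∈ₛ body K × b ≢ g)
    other with cover K (entry∈ eg)
    ... | inj₁ g∈V = let b , b∈ = right-inhabited K in b , right K b∈ , λ { refl → disjoint K g∈V b∈ }
    ... | inj₂ g∈W = let b , b∈ = left-inhabited K in b , left K b∈ , λ { refl → disjoint K b∈ g∈W }

  non-cut-neighbour : ∀ {V W w y} (K : Parts V W) → w ∈ₛ V → ¬ Cut w → Adj G w y → y ∈ₛ W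
  non-cut-neighbour {W = W} {y = y} K w∈ ¬cut w~y with y ∈ₛ? body K
  ... | no y∉ = contradiction (entry-is-cut K y∉ (from y∉ (~sym w~y) (at (left K w∈)))) ¬cut
  ... | yes y∈ with cover K y∈
  ...   | inj₁ y∈V = ⊥-elim (left-indep K w∈ y∈V w~y)
  ...   | inj₂ y∈W = y∈W

  -- A neighbour `u` of `w` in the second block also lies in the first, so the second block is
  -- contained in the first. As `x` is adjacent to `u`, which is in `W`, it must be in `V`.
  non-cut-part-unique : ∀ {V W V' W' w x} → Parts V W → Parts V' W' → w ∈ₛ V → w ∈ₛ V' → ¬ Cut w
    → x ∈ₛ V' → x ∈ₛ V
  non-cut-part-unique K K' w∈V w∈V' ¬cut x∈V' with right-inhabited K'
  ... | u , u∈W' with non-cut-neighbour K w∈V ¬cut (cross K' w∈V' u∈W')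
  ...   | u∈W with cover K (shared-pair⇒⊆ (block K) (block K') (λ { refl → disjoint K w∈V u∈W })
                              (left K w∈V) (right K u∈W) (left K' w∈V') (right K' u∈W') (left K' x∈V'))
  ...     | inj₁ x∈V = x∈V
  ...     | inj₂ x∈W = ⊥-elim (right-indep K x∈W u∈W (cross K' x∈V' u∈W'))

  -- A non-cut-vertex w has no neighbours outside the opposite part, all of which are adjacent to t.
  dist-≤-non-cut : ∀ {V W w t y} → Parts V W → w ∈ₛ V → t ∈ₛ V → ¬ Cut w → y ≢ w → dist t y ≤ dist w y
  dist-≤-non-cut {w = w} {y = y} K w∈ t∈ ¬cut y≢w with dist w y | geodesic w y
  ... | _ | here _ = contradiction refl y≢w
  ... | _ | step _ e u = dist-min (step tt (cross K t∈ (non-cut-neighbour K w∈ ¬cut e)) u)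

  outside-vertex : ∀ {B} → IsBlock G B → ∃[ y ] (¬ y ∈ₛ B)
  outside-vertex {B} blk with any? (λ y → ¬? (y ∈ₛ? B)) | proj₁ (proj₂ cls)
  ... | yes found | _ = found
  ... | no none | B₁ , B₂ , _ , blk₂ , x , _ , x∉B₂ =
        ⊥-elim (x∉B₂ (proj₂ (proj₂ blk₂) B (λ y _ → everything y) (proj₁ blk) (proj₁ (proj₂ blk)) x (everything x)))
    where
    everything : ∀ y → y ∈ₛ B
    everything y = decidable-stable (y ∈ₛ? B) (λ y∉ → none (y , y∉))

  cut-in-block : ∀ {V W} (K : Parts V W) → ∃[ c ] (c ∈ₛ body K × Cut c)
  cut-in-block K =
    let y , y∉ = outside-vertex (block K)
        g , _ , eg = entry-of (left K (proj₂ (left-inhabited K))) y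
    in g , entry∈ eg , entry-is-cut K y∉ eg

  third-cut : ∀ {V W a b c} (K : Parts V W) → a ≢ b → a ∈ₛ body K → b ∈ₛ body K → c ∈ₛ body K
    → Cut a → Cut b → Cut c → c ≡ a ⊎ c ≡ b
  third-cut K a≢b a∈ b∈ c∈ ca cb cc with proj₂ (proj₂ cls) (body K) (block K) _ _ _ a∈ b∈ c∈ ca cb cc
  ... | inj₁ a≡b = contradiction a≡b a≢b
  ... | inj₂ (inj₁ a≡c) = inj₁ (sym a≡c)
  ... | inj₂ (inj₂ b≡c) = inj₂ (sym b≡c)

  NonCutInT TwoCuts : VSet n → Set
  NonCutInT V = ∃[ u ] (u ∈ₛ V × ¬ Cut u × T u)
  TwoCuts V = ∃[ a ] ∃[ b ] (a ≢ b × a ∈ₛ V × b ∈ₛ V × Cut a × Cut b)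

  CutIn : VSet n → Set
  CutIn V = ∃[ a ] (a ∈ₛ V × Cut a)

  -- The non-cut-vertex of minimum label in `V` is chosen for `T` if the block has `IsK11`, is a
  -- leaf block, or has two cut-vertices in `W`. What remains is two cut-vertices in `V`, or one in
  -- each part.
  non-cut-part : ∀ {V W w} → Parts V W → w ∈ₛ V → ¬ Cut w
    → ¬ ¬ (NonCutInT V ⊎ TwoCuts V ⊎ (CutIn V × CutIn W))
  non-cut-part {V} {W} {w} K w∈ ¬cut = do
      u , (u∈ , ¬cu) , min ← ∃-minimal {P = λ x → x ∈ₛ V × ¬ Cut x} (w∈ , ¬cut)
      let minimal : MinNonCut G V u
          minimal = u∈ , ¬cu , λ y y∈ ¬cy → min y (y∈ , ¬cy)
          represented : InNC G (body K) V W u → NonCutInT V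
          represented nc = u , u∈ , ¬cu , inj₂ (_ , _ , _ , block K , bipartition K , nc)
          leaf : ¬ IsK11 G V W → IsLeafBlock G (body K) → NonCutInT V
          leaf ¬k11 isLeaf = represented (inj₁ (¬k11 , inj₂ (inj₂ (isLeaf , inj₁ minimal))))
      no ¬k11 ← lem (IsK11 G V W)
        where yes k11 → pure (inj₁ (represented (inj₂ (k11 , inj₁ minimal))))
      cutV ← lem (CutIn V)
      cutW ← lem (CutIn W)
      twoV ← lem (TwoCuts V)
      twoW ← lem (TwoCuts W)
      pure (analyse minimal represented (leaf ¬k11) ¬k11 cutV cutW twoV twoW)
    where
    analyse : ∀ {u} → MinNonCut G V u → (InNC G (body K) V W u → NonCutInT V)
      → (IsLeafBlock G (body K) → NonCutInT V) → ¬ IsK11 G V W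
      → Dec (CutIn V) → Dec (CutIn W) → Dec (TwoCuts V) → Dec (TwoCuts W)
      → NonCutInT V ⊎ TwoCuts V ⊎ (CutIn V × CutIn W)
    analyse _ _ _ _ (yes a) (yes b) _ _ = inj₂ (inj₂ (a , b))
    analyse _ _ _ _ (yes _) (no _) (yes ab) _ = inj₂ (inj₁ ab)
    analyse _ _ leaf _ (yes (a , a∈ , ca)) (no noW) (no ¬two) _ = inj₁ (leaf (a , left K a∈ , ca , unique))
      where
      unique : ∀ c → c ∈ₛ body K → Cut c → c ≡ a
      unique c c∈ cc with c ≟ a | cover K c∈
      ... | yes c≡a | _ = c≡a
      ... | no c≢a | inj₁ c∈V = contradiction (c , a , c≢a , c∈V , a∈ , cc , ca) ¬two
      ... | no _ | inj₂ c∈W = contradiction (c , c∈W , cc) noW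
    analyse minimal rep _ ¬k11 (no _) (yes _) _ (yes (a , b , a≢b , a∈ , b∈ , ca , cb)) =
      inj₁ (rep (inj₁ (¬k11 , inj₂ (inj₁ ((a , b , a≢b , a∈ , b∈ , ca , cb ,
        λ c c∈ cc → third-cut K a≢b (right K a∈) (right K b∈) (right K c∈) ca cb cc) , minimal)))))
    analyse _ _ leaf _ (no noV) (yes (b , b∈ , cb)) _ (no ¬two) = inj₁ (leaf (b , right K b∈ , cb , unique))
      where
      unique : ∀ c → c ∈ₛ body K → Cut c → c ≡ b
      unique c c∈ cc with c ≟ b | cover K c∈
      ... | yes c≡b | _ = c≡b
      ... | no c≢b | inj₂ c∈W = contradiction (c , b , c≢b , c∈W , b∈ , cc , cb) ¬two
      ... | no _ | inj₁ c∈V = contradiction (c , c∈V , cc) noV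
    analyse _ _ _ _ (no noV) (no noW) _ _ with cut-in-block K
    ... | c , c∈ , cc with cover K c∈
    ...   | inj₁ c∈V = contradiction (c , c∈V , cc) noV
    ...   | inj₂ c∈W = contradiction (c , c∈W , cc) noW

  part-meets-T : ∀ {V W} → Parts V W → ¬ ¬ (∃[ t ] (t ∈ₛ V × T t))
  part-meets-T {V} K = do
      no none ← lem (CutIn V)
        where yes (a , a∈ , ca) → pure (a , a∈ , inj₁ ca)
      let w , w∈ = left-inhabited K
      inj₁ (u , u∈ , _ , tu) ← non-cut-part K w∈ (λ cw → none (w , w∈ , cw))
        where inj₂ (inj₁ (a , _ , _ , a∈ , _ , ca , _)) → contradiction (a , a∈ , ca) none
              inj₂ (inj₂ (a , _)) → contradiction a none
      pure (u , u∈ , tu)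

  last-before-entry : ∀ {B x g k} → x ≢ g → Enters B x g k → ∃[ y ] (¬ y ∈ₛ B × Adj G g y)
  last-before-entry x≢g eg =
    let y , _ , w , y~g = before-entry (λ x∈ → x≢g (enters-member x∈ eg)) eg in y , source∈ (reverse w) , ~sym y~g

  -- If neither of the separated vertices `a`, `b` entered the block at `h`, they could be joined
  -- through the block without `h`. So one does, and the last vertex before its entry is the
  -- neighbour sought.
  exit : ∀ {V W h} (K : Parts V W) → h ∈ₛ body K → Cut h → ∃[ c ] (¬ c ∈ₛ body K × Adj G h c)
  exit {h = h} K h∈ (a , b , a≢h , b≢h , separated) with entry-of h∈ a | entry-of h∈ b
  ... | g , _ , eg | g' , _ , eg' with g ≟ h | g' ≟ h
  ...   | yes refl | _ = last-before-entry a≢h eg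
  ...   | no _ | yes refl = last-before-entry b≢h eg'
  ...   | no g≢h | no g'≢h =
          ⊥-elim (separated (_ , enters⇒walk avoid g≢h eg ++ʷ (proj₂ middle ++ʷ reverse (enters⇒walk avoid g'≢h eg'))))
    where
    avoid : ∀ {x} → ¬ x ∈ₛ body K → x ≢ h
    avoid x∉ refl = x∉ h∈

    middle : ∃ (Walk G (_≢ h) g g')
    middle = let _ , w = proj₁ (proj₂ (block K)) h h∈ g g' (entry∈ eg , g≢h) (entry∈ eg' , g'≢h)
             in _ , map-walk proj₂ w

  -- `c` is traded for a vertex `t` of `T` in its part of the block of the edge from `h` to `c`.
  -- Were `t` in the old block, the blocks would share `h` and `t`, and `c` would be inside as well.
  exit-in-T : ∀ {V W h} (K : Parts V W) → h ∈ₛ body K → Cut h → ¬ ¬ (∃[ c ] (¬ c ∈ₛ body K × T c × Adj G h c))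
  exit-in-T K h∈ ch = do
    let c , c∉ , h~c = exit K h∈ ch
    _ , _ , K' , h∈V' , c∈W' ← edge-parts h~c
    t , t∈W' , tt' ← part-meets-T (flip K')
    let h~t = cross K' h∈V' t∈W'
    pure (t , (λ t∈ → c∉ (shared-pair⇒⊆ (block K) (block K') (~⇒≢ h~t) h∈ t∈ (left K' h∈V') (right K' t∈W')
                            (right K' c∈W')))
         , tt' , h~t)

-- The retraction onto `T`

module Tree {n : ℕ} (G : Graph n) (conn : Connected G AllV) (cls : InClassB G) where
  open BiBlock G conn cls public
  open Parts

  -- Moving every vertex outside T to a vertex of T in the same part is a retraction onto T.
  Represents : Fin n → Fin n → Set
  Represents t x = T t × (x ≡ t ⊎ (¬ T x × ∃[ V ] ∃[ W ] (Parts V W × x ∈ₛ V × t ∈ₛ V)))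

  represents-part : ∀ {V W x y t} → Parts V W → x ∈ₛ V → y ∈ₛ W → Represents t x → t ∈ₛ V
  represents-part K x∈ y∈ (_ , inj₁ refl) = x∈
  represents-part K x∈ y∈ (_ , inj₂ (x∉T , _ , _ , K' , x∈V' , t∈V')) =
    non-cut-part-unique K K' x∈ x∈V' (∉T⇒¬cut x∉T) t∈V'

  -- Every edge joins opposite parts of a block and representatives stay in their part, so replacing
  -- vertices one by one keeps adjacency and length. The end `y` is in `T` and stays fixed.
  retract-walk : ∀ {x y t k} → Walk G AllV x y k → Represents t x → T y → ¬ ¬ Walk G T t y k
  retract-walk (here _) (Tt , inj₁ refl) Ty = pure (here Tt)
  retract-walk (here _) (_ , inj₂ (x∉T , _)) Ty = contradiction Ty x∉T
  retract-walk (step {y = u} _ x~u w) rep Ty = do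
    _ , _ , K , x∈V , u∈W ← edge-parts x~u
    let t∈V = represents-part K x∈V u∈W rep
    no u∉T ← lem (T u)
      where yes Tu → do w' ← retract-walk w (Tu , inj₁ refl) Ty
                        pure (step (proj₁ rep) (cross K t∈V u∈W) w')
    s , s∈W , Ts ← part-meets-T (flip K)
    w' ← retract-walk w (Ts , inj₂ (u∉T , _ , _ , flip K , u∈W , s∈W)) Ty
    pure (step (proj₁ rep) (cross K t∈V s∈W) w')

  T-isometric : ∀ {x y k} → T x → T y → Walk G AllV x y k → ¬ ¬ Walk G T x y k
  T-isometric Tx Ty w = retract-walk w (Tx , inj₁ refl) Ty

  -- Let `x` enter the block of `v` at `g`. If `g` is in `W`, any vertex of `T` in `V` is as far as
  -- `v`. If `g` is in `V`, a vertex of `T` at least 2 beyond `g` suffices. The search fails only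
  -- when the vertex of `T` found in `V` is `g` itself and not a cut-vertex; then `x` equals `g`.
  as-far-in-T : ∀ {V W v} x → Parts V W → v ∈ₛ V → ¬ Cut v
    → ¬ ¬ ((∃[ t ] (T t × dist x v ≤ dist x t)) ⊎ (x ∈ₛ V × ¬ Cut x))
  as-far-in-T {V} {W} {v} x K v∈ ¬cv with entry-of (left K v∈) x
  ... | g , _ , eg with cover K (entry∈ eg)
  ...   | inj₂ g∈W = do
          t , t∈V , Tt ← part-meets-T K
          pure (inj₁ (t , Tt , ≤-trans (dist-triangle x g v)
            (≤-trans (+-monoʳ-≤ (dist x g) (≤-trans (adj⇒dist≤1 (~sym (cross K v∈ g∈W)))
                                                    (≢⇒1≤dist (λ { refl → disjoint K t∈V g∈W }))))
                     (dist-via-entry (block K) eg (left K t∈V)))))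
  ...   | inj₁ g∈V = do
          inj₁ (u , u∈V , ¬cu , Tu) ← non-cut-part K v∈ ¬cv
            where inj₂ (inj₁ (a , b , a≢b , a∈ , b∈ , ca , cb)) → pure (inj₁ (two-cuts a≢b a∈ b∈ ca cb))
                  inj₂ (inj₂ (_ , b , b∈ , cb)) → do
                    c , c∉ , Tc , b~c ← exit-in-T K (right K b∈) cb
                    pure (inj₁ (c , Tc , beyond b∈ c∉ b~c))
          pure (non-cut-in-T u∈V ¬cu Tu)
    where
    near : ∀ {t} → dist x g + 2 ≤ dist x t → dist x v ≤ dist x t
    near = ≤-trans (≤-trans (dist-triangle x g v) (+-monoʳ-≤ (dist x g) (left-dist≤2 K g∈V v∈)))

    in-part : ∀ {t} → t ∈ₛ V → g ≢ t → dist x v ≤ dist x t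
    in-part t∈ g≢t = near (≤-trans (+-monoʳ-≤ (dist x g) (left≢⇒2≤dist K g∈V t∈ g≢t))
                                   (dist-via-entry (block K) eg (left K t∈)))

    beyond : ∀ {b c} → b ∈ₛ W → ¬ c ∈ₛ body K → Adj G b c → dist x v ≤ dist x c
    beyond {b} {c} b∈ c∉ b~c = near (begin
      dist x g + 2                     ≡⟨ +-assoc (dist x g) 1 1 ⟨
      dist x g + 1 + 1                 ≤⟨ +-mono-≤ (+-monoʳ-≤ (dist x g) (≢⇒1≤dist g≢b)) (≢⇒1≤dist (~⇒≢ b~c)) ⟩
      dist x g + dist g b + dist b c   ≤⟨ dist-via-entries (block K) eg (from c∉ (~sym b~c) (at (right K b∈))) g≢b ⟩
      dist x c                         ∎)
      where
      open ≤-Reasoning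
      g≢b : g ≢ b
      g≢b refl = disjoint K g∈V b∈

    two-cuts : ∀ {a b} → a ≢ b → a ∈ₛ V → b ∈ₛ V → Cut a → Cut b → ∃[ t ] (T t × dist x v ≤ dist x t)
    two-cuts {a} {b} a≢b a∈ b∈ ca cb with g ≟ a
    ... | yes refl = b , inj₁ cb , in-part b∈ a≢b
    ... | no g≢a = a , inj₁ ca , in-part a∈ g≢a

    non-cut-in-T : ∀ {u} → u ∈ₛ V → ¬ Cut u → T u → (∃[ t ] (T t × dist x v ≤ dist x t)) ⊎ (x ∈ₛ V × ¬ Cut x)
    non-cut-in-T {u} u∈ ¬cu Tu with g ≟ u | x ∈ₛ? body K
    ... | no g≢u | _ = inj₁ (u , Tu , in-part u∈ g≢u)
    ... | yes refl | no x∉ = contradiction (entry-is-cut K x∉ eg) ¬cu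
    ... | yes refl | yes x∈ with enters-member x∈ eg
    ...   | refl = inj₂ (u∈ , ¬cu)

  non-cut-in-parts : ∀ {x y} → x ≢ y → ¬ ¬ (∃[ V ] ∃[ W ] (Parts V W × x ∈ₛ V))
  non-cut-in-parts {x} {y} x≢y with dist x y | geodesic x y
  ... | _ | here _ = contradiction refl x≢y
  ... | _ | step _ x~u _ = do
        V , W , K , x∈ , _ ← edge-parts x~u
        pure (V , W , K , x∈)

  -- Comparing the centres of `T` and `G`

  module Centre (d : ℕ) (diam : Diam G AllV d) (4≤d : 4 ≤ d)
                (z₀ : Fin n) (z₀-central : InCenter G T z₀)
                -- This hypothesis serves both parities: with a single central vertex it is vacuous,
                -- and for odd `d` the two central vertices are adjacent and `d` is at least 5.
                (central-pair : ∀ {x y} → InCenter G T x → InCenter G T y → x ≢ y → Adj G x y × 5 ≤ d) where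

    Z : Fin n → Set
    Z = InCenter G T

    r : ℕ
    r = proj₁ z₀-central

    Z-radius : ∀ {z} → (c : Z z) → proj₁ c ≡ r
    Z-radius (e , ecc , min) =
      ≤-antisym (min _ _ (proj₁ (proj₂ z₀-central))) (proj₂ (proj₂ z₀-central) _ _ ecc)

    T-dist≤r : ∀ {z y} → Z z → T y → dist z y ≤ r
    T-dist≤r c@(_ , (_ , le , _) , _) Ty =
      let _ , (w , _) , k≤e = le _ Ty in ≤-trans (dist-min (forget w)) (≤-trans k≤e (≤-reflexive (Z-radius c)))

    Dist-T≤dist : ∀ {x y k} → T x → T y → Dist G T x y k → k ≤ dist x y
    Dist-T≤dist Tx Ty (_ , min) = ≤-¬¬ do
      w ← T-isometric Tx Ty (geodesic _ _)
      pure (min _ w)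

    T-dist≥r : ∀ {z} → Z z → ∃[ y ] (T y × r ≤ dist z y)
    T-dist≥r c@(_ , (Tz , _ , y , Ty , dy) , _) =
      y , Ty , ≤-trans (≤-reflexive (sym (Z-radius c))) (Dist-T≤dist Tz Ty dy)

    T-connected : Connected G T
    T-connected u v Tu Tv =
      let le = proj₁ (proj₂ (proj₁ (proj₂ z₀-central)))
          _ , (p , _) , _ = le u Tu
          _ , (q , _) , _ = le v Tv
      in _ , reverse p ++ʷ q

    near-T⇒Z : ∀ {w} → T w → (∀ y → T y → dist w y ≤ r) → ¬ ¬ Z w
    near-T⇒Z {w} Tw near = do
      T? ← ∀¬¬⇒¬¬∀ (λ x → lem (T x))
      let e , ecc@(_ , _ , y , Ty , dy) = eccentricity T? T-connected w Tw
          e≤r = ≤-trans (Dist-T≤dist Tw Ty dy) (near y Ty)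
      pure (e , ecc , λ v e' ecc' → ≤-trans e≤r (proj₂ (proj₂ z₀-central) v e' ecc'))

    Within : Fin n → ℕ → Set
    Within x m = ∀ y → dist x y ≤ m

    diametral : ∃[ p ] ∃[ q ] (d ≤ dist p q)
    diametral = let p , _ , _ , q , _ , dq = proj₁ diam in p , q , ≤-reflexive (Dist⇒≡dist dq)

    in-parts : ∀ x → ¬ ¬ (∃[ V ] ∃[ W ] (Parts V W × x ∈ₛ V))
    in-parts x with diametral
    ... | p , q , d≤ with x ≟ p
    ...   | no x≢p = non-cut-in-parts x≢p
    ...   | yes refl = non-cut-in-parts {x} {q} λ { refl → <⇒≱ (≤-trans (s≤s z≤n) 4≤d) (≤-trans d≤ (dist-self x)) }

    Twin : Fin n → Fin n → Set
    Twin z v = ¬ Cut z × ∃[ V ] ∃[ W ] (Parts V W × z ∈ₛ V × v ∈ₛ V)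

    reach-from-Z : ∀ {z} → Z z → ∀ v → ¬ ¬ (dist z v ≤ r ⊎ Twin z v)
    reach-from-Z {z} c v = do
      no v∉T ← lem (T v)
        where yes Tv → pure (inj₁ (T-dist≤r c Tv))
      V , W , K , v∈ ← in-parts v
      inj₁ (t , Tt , le) ← as-far-in-T z K v∈ (∉T⇒¬cut v∉T)
        where inj₂ (z∈ , ¬cz) → pure (inj₂ (¬cz , V , W , K , z∈ , v∈))
      pure (inj₁ (≤-trans le (T-dist≤r c Tt)))

    twin-dist≤2 : ∀ {z v} → Twin z v → dist z v ≤ 2
    twin-dist≤2 (_ , _ , _ , K , z∈ , v∈) = left-dist≤2 K z∈ v∈

    -- If `r ≤ 1`, each end of a diametral pair is within 1 of `z₀` or is a twin of it, at distance
    -- at most 2, and the pair is less than 4 apart. The bound later absorbs twins.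
    2≤r : 2 ≤ r
    2≤r with r ≤? 1 | diametral
    ... | no r≰1 | _ = ≰⇒> r≰1
    ... | yes r≤1 | p , q , d≤ = ⊥-elim ((do
          rp ← reach-from-Z z₀-central p
          rq ← reach-from-Z z₀-central q
          pure (<⇒≱ 4≤d (≤-trans d≤ (close rp rq)))) (λ ()))
      where
      through : ∀ {k l} → dist z₀ p ≤ k → dist z₀ q ≤ l → dist p q ≤ k + l
      through hp hq = ≤-trans (dist-triangle p z₀ q) (+-mono-≤ (≤-trans (≤-reflexive (dist-sym p z₀)) hp) hq)

      close : dist z₀ p ≤ r ⊎ Twin z₀ p → dist z₀ q ≤ r ⊎ Twin z₀ q → dist p q ≤ 3
      close (inj₁ hp) (inj₁ hq) = m≤n⇒m≤1+n (through (≤-trans hp r≤1) (≤-trans hq r≤1))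
      close (inj₁ hp) (inj₂ tq) = through (≤-trans hp r≤1) (twin-dist≤2 tq)
      close (inj₂ tp) (inj₁ hq) = through (twin-dist≤2 tp) (≤-trans hq r≤1)
      -- The route through `z₀` would only give 4, but two twins of `z₀` lie in one part.
      close (inj₂ (¬cz , _ , _ , K , z∈ , p∈)) (inj₂ (_ , _ , _ , K' , z∈' , q∈)) =
        m≤n⇒m≤1+n (left-dist≤2 K p∈ (non-cut-part-unique K K' z∈ z∈' ¬cz q∈))

    Z⇒within : ∀ {z} → Z z → Within z r
    Z⇒within c v = ≤-¬¬ do
      inj₂ twin ← reach-from-Z c v
        where inj₁ le → pure le
      pure (≤-trans (twin-dist≤2 twin) 2≤r)

    d≤2r : d ≤ r + r
    d≤2r = let p , q , d≤ = diametral in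
      ≤-trans d≤ (≤-trans (dist-triangle p z₀ q)
        (+-mono-≤ (≤-trans (≤-reflexive (dist-sym p z₀)) (Z⇒within z₀-central p)) (Z⇒within z₀-central q)))

    5≤d⇒3≤r : 5 ≤ d → 3 ≤ r
    5≤d⇒3≤r 5≤d with r ≤? 2
    ... | no r≰2 = ≰⇒> r≰2
    ... | yes r≤2 = contradiction (≤-trans d≤2r (+-mono-≤ r≤2 r≤2)) (<⇒≱ 5≤d)

    -- The comparison `dist-≤-non-cut` leaves out `y = w`, where `2 ≤ m` takes over.
    within-part : ∀ {V W w t m} → Parts V W → w ∈ₛ V → t ∈ₛ V → ¬ Cut w → 2 ≤ m → Within w m → Within t m
    within-part {w = w} {t} K w∈ t∈ ¬cw 2≤m near y with y ≟ w
    ... | yes refl = ≤-trans (left-dist≤2 K t∈ w∈) 2≤m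
    ... | no y≢w = ≤-trans (dist-≤-non-cut K w∈ t∈ ¬cw y≢w) (near y)

    within⇒Z : ∀ {w} → T w → Within w r → ¬ ¬ Z w
    within⇒Z Tw near = near-T⇒Z Tw (λ y _ → near y)

    -- A cut-vertex `w` would belong to `T` and be central, hence adjacent to `z`, although both are
    -- in one part.
    twin⇒¬cut : ∀ {z w} → Z z → Twin z w → ¬ Cut w
    twin⇒¬cut {z} {w} c (¬cz , _ , _ , K , z∈ , w∈) cw = within⇒Z (inj₁ cw) (within-part K z∈ w∈ ¬cz 2≤r (Z⇒within c))
      λ c' → left-indep K z∈ w∈ (proj₁ (central-pair c c' λ { refl → ¬cz cw }))

    twin⇒within : ∀ {z w} → Z z → Twin z w → Within w r
    twin⇒within c (¬cz , _ , _ , K , z∈ , w∈) = within-part K z∈ w∈ ¬cz 2≤r (Z⇒within c)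

    -- Every vertex outside the block enters it at `a` or `b`. One entering at `a` is 2 farther from
    -- `w` than from `a`, so it is within `r` of `b`; one entering at `b` is nearer to `b` than to
    -- `w`. This makes `b` central along with `a`.
    cuts-in-both-parts : ∀ {V W w a b} → Parts V W → w ∈ₛ V → ¬ Cut w → a ∈ₛ V → b ∈ₛ W → Cut a → Cut b
      → Within w r → ⊥
    cuts-in-both-parts {V} {W} {w} {a} {b} K w∈ ¬cw a∈ b∈ ca cb near =
      within⇒Z (inj₁ ca) (within-part K w∈ a∈ ¬cw 2≤r near) λ Za →
      within⇒Z (inj₁ cb) b-near λ Zb → impossible Za Zb
      where
      a≢b : a ≢ b
      a≢b refl = disjoint K a∈ b∈

      dist-ab≤1 : dist a b ≤ 1
      dist-ab≤1 = adj⇒dist≤1 (cross K a∈ b∈)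

      entries : ∀ {y} → ¬ y ∈ₛ body K → ∃ (Enters (body K) y a) ⊎ ∃ (Enters (body K) y b)
      entries {y} y∉ with entry-of (left K w∈) y
      ... | g , k , eg with third-cut K a≢b (left K a∈) (right K b∈) (entry∈ eg) ca cb (entry-is-cut K y∉ eg)
      ...   | inj₁ refl = inj₁ (k , eg)
      ...   | inj₂ refl = inj₂ (k , eg)

      via-a : ∀ {y} → ∃ (Enters (body K) y a) → dist y a + 2 ≤ r
      via-a {y} (_ , ea) = ≤-trans
        (≤-trans (+-monoʳ-≤ (dist y a) (left≢⇒2≤dist K a∈ w∈ λ { refl → ¬cw ca })) (dist-via-entry (block K) ea (left K w∈)))
        (≤-trans (≤-reflexive (dist-sym y w)) (near y))

      via-b : ∀ {y} → ∃ (Enters (body K) y b) → ∀ {v} → v ∈ₛ V → dist y b + 1 ≤ dist v y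
      via-b {y} (_ , eb) {v} v∈ = ≤-trans
        (≤-trans (+-monoʳ-≤ (dist y b) (≢⇒1≤dist λ { refl → disjoint K v∈ b∈ })) (dist-via-entry (block K) eb (left K v∈)))
        (≤-reflexive (dist-sym y v))

      b-near : Within b r
      b-near y with y ∈ₛ? body K
      ... | yes y∈ = ≤-trans (block-dist≤2 K (right K b∈) y∈) 2≤r
      ... | no y∉ with entries y∉
      ...   | inj₂ eb = ≤-trans (≤-reflexive (dist-sym b y)) (≤-trans (m≤m+n _ 1) (≤-trans (via-b eb w∈) (near y)))
      ...   | inj₁ ea = ≤-trans (≤-reflexive (dist-sym b y))
                (≤-trans (dist-triangle y a b) (≤-trans (+-monoʳ-≤ (dist y a) (m≤n⇒m≤1+n dist-ab≤1)) (via-a ea)))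

      impossible : Z a → Z b → ⊥
      -- Take `y` at distance at least `r` from `b`. As `r` is at least 3, it is outside the block.
      -- Entering at `b`, it is at least `r + 1` from `a`; entering at `a`, it is closer to `b` than
      -- to `w`, hence closer than `r`.
      impossible Za Zb with T-dist≥r Zb | 5≤d⇒3≤r (proj₂ (central-pair Za Zb a≢b))
      ... | y , _ , r≤ | 3≤r with y ∈ₛ? body K
      ...   | yes y∈ = <⇒≱ 3≤r (≤-trans r≤ (block-dist≤2 K (right K b∈) y∈))
      ...   | no y∉ with entries y∉
      ...     | inj₂ eb = <-irrefl refl (≤-trans (≤-reflexive (+-comm 1 r)) (≤-trans (+-monoˡ-≤ 1
                  (≤-trans r≤ (≤-reflexive (dist-sym b y)))) (≤-trans (via-b eb a∈) (Z⇒within Za y))))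
      ...     | inj₁ ea = <-irrefl refl (begin-strict
                  r                         ≤⟨ r≤ ⟩
                  dist b y                  ≡⟨ dist-sym b y ⟩
                  dist y b                  ≤⟨ dist-triangle y a b ⟩
                  dist y a + dist a b       ≤⟨ +-monoʳ-≤ (dist y a) dist-ab≤1 ⟩
                  dist y a + 1              <⟨ +-monoʳ-< (dist y a) (s≤s (s≤s z≤n)) ⟩
                  dist y a + 2              ≤⟨ via-a ea ⟩
                  r                         ∎)
        where open ≤-Reasoning

    -- A vertex of `T` in the part of `w` inherits the bound `r` and is central. Two cut-vertices in
    -- that part would both be central and yet not adjacent.
    within⇒central : ∀ {w} → Within w r → ¬ ¬ (Z w ⊎ ∃[ z ] (Z z × Twin z w))
    within⇒central {w} near = do
      no w∉T ← lem (T w)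
        where yes Tw → do Zw ← within⇒Z Tw near
                          pure (inj₁ Zw)
      let ¬cw = ∉T⇒¬cut w∉T
      V , W , K , w∈ ← in-parts w
      inj₁ (u , u∈ , ¬cu , Tu) ← non-cut-part K w∈ ¬cw
        where inj₂ (inj₁ (a , b , a≢b , a∈ , b∈ , ca , cb)) → do
                Za ← within⇒Z (inj₁ ca) (within-part K w∈ a∈ ¬cw 2≤r near)
                Zb ← within⇒Z (inj₁ cb) (within-part K w∈ b∈ ¬cw 2≤r near)
                contradiction (proj₁ (central-pair Za Zb a≢b)) (left-indep K a∈ b∈)
              inj₂ (inj₂ ((a , a∈ , ca) , (b , b∈ , cb))) →
                ⊥-elim (cuts-in-both-parts K w∈ ¬cw a∈ b∈ ca cb near)
      Zu ← within⇒Z Tu (within-part K w∈ u∈ ¬cw 2≤r near)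
      pure (inj₂ (u , Zu , ¬cu , V , W , K , u∈ , w∈))

    central⇒r≤ : ∀ {w m} → Z w ⊎ ∃[ z ] (Z z × Twin z w) → Within w m → r ≤ m
    central⇒r≤ (inj₁ Zw) near = let y , _ , r≤ = T-dist≥r Zw in ≤-trans r≤ (near y)
    central⇒r≤ {w} {m} (inj₂ (z , Zz , twin@(_ , _ , _ , K , z∈ , w∈))) near with T-dist≥r Zz
    ... | y , _ , r≤ with y ≟ w
    ...   | yes refl = ≤-trans r≤ (≤-trans (≤-reflexive (dist-sym z y)) (near z))
    ...   | no y≢w = ≤-trans r≤ (≤-trans (dist-≤-non-cut K w∈ z∈ (twin⇒¬cut Zz twin) y≢w) (near y))

    -- If `m` were below `r`, then `w` would be central in `T` or a twin, and `central⇒r≤` applies.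
    -- With `Z⇒within`, this makes `r` the radius of `G`.
    r-least : ∀ {w m} → Within w m → r ≤ m
    r-least {w} {m} near with r ≤? m
    ... | yes r≤m = r≤m
    ... | no r≰m = ≤-¬¬ do
          central ← within⇒central {w} (λ y → ≤-trans (near y) (<⇒≤ (≰⇒> r≰m)))
          pure (central⇒r≤ central near)

    Ecc⇒within : ∀ {w e} → Ecc G AllV w e → Within w e
    Ecc⇒within (_ , le , _) y = let _ , dy , k≤e = le y tt in ≤-trans (≤-reflexive (sym (Dist⇒≡dist dy))) k≤e

    within⇒InCenter : ∀ {w} → Within w r → InCenter G AllV w
    within⇒InCenter {w} near =
      let e , ecc@(_ , _ , y , _ , dy) = eccentricity (λ _ → yes tt) conn w tt
      in e , ecc , λ v e' ecc' →
           ≤-trans (≤-trans (≤-reflexive (Dist⇒≡dist dy)) (near y)) (r-least (Ecc⇒within ecc'))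

    InCenter⇒within : ∀ {w} → InCenter G AllV w → Within w r
    InCenter⇒within (e , ecc , min) y =
      let e' , ecc'@(_ , _ , y' , _ , dy') = eccentricity (λ _ → yes tt) conn z₀ tt
      in ≤-trans (Ecc⇒within ecc y) (≤-trans (min z₀ e' ecc')
           (≤-trans (≤-reflexive (Dist⇒≡dist dy')) (Z⇒within z₀-central y')))

    central⇒InCenter : ∀ {w} → Z w ⊎ ∃[ z ] (Z z × Twin z w) → InCenter G AllV w
    central⇒InCenter (inj₁ Zw) = within⇒InCenter (Z⇒within Zw)
    central⇒InCenter (inj₂ (_ , Zz , twin)) = within⇒InCenter (twin⇒within Zz twin)

    InCenter⇒central : ∀ {w} → InCenter G AllV w → ¬ ¬ (Z w ⊎ ∃[ z ] (Z z × Twin z w))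
    InCenter⇒central c = within⇒central (InCenter⇒within c)

theorem3p14 : ∀ {n} (G : Graph n) → Connected G AllV → InClassB G
    → ∀ d → Diam G AllV d → 4 ≤ d
    → ((2 ∣ d) → ∀ (z : Fin n) B V1 V2 → IsBlock G B → IsCompleteBipartition G B V1 V2
    → z ∈ₛ V1 → SameSet (InCenter G (InTG G)) (λ x → x ≡ z)
    → (IsCutVertex G z → SameSet (InCenter G AllV) (λ x → x ≡ z))
    × (¬ IsCutVertex G z → SameSet (InCenter G AllV) (λ x → x ∈ₛ V1)))
    × ((¬ (2 ∣ d)) → ∀ (z₁ z₂ : Fin n) B V1 V2 → IsBlock G B → IsCompleteBipartition G B V1 V2
    → z₁ ∈ₛ V1 → z₂ ∈ₛ V2 → SameSet (InCenter G (InTG G)) (λ x → (x ≡ z₁) ⊎ (x ≡ z₂))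
    → (IsCutVertex G z₁ → IsCutVertex G z₂ → SameSet (InCenter G AllV) (λ x → (x ≡ z₁) ⊎ (x ≡ z₂)))
    × (IsCutVertex G z₁ → ¬ IsCutVertex G z₂ → SameSet (InCenter G AllV) (λ x → (x ≡ z₁) ⊎ (x ∈ₛ V2)))
    × (¬ IsCutVertex G z₁ → IsCutVertex G z₂ → SameSet (InCenter G AllV) (λ x → (x ≡ z₂) ⊎ (x ∈ₛ V1))))

-- The even and odd cases

theorem3p14 {n} G conn cls d diam 4≤d = even , odd
  where
  open Tree G conn cls

  even : (2 ∣ d) → ∀ (z : Fin n) B V1 V2 → IsBlock G B → IsCompleteBipartition G B V1 V2
    → z ∈ₛ V1 → SameSet (InCenter G T) (λ x → x ≡ z)
    → (Cut z → SameSet (InCenter G AllV) (λ x → x ≡ z))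
    × (¬ Cut z → SameSet (InCenter G AllV) (λ x → x ∈ₛ V1))
  even _ z B V1 V2 blk bip z∈ same = cut , non-cut
    where
    K : Parts V1 V2
    K = record { block = blk ; bipartition = bip }

    Zz : InCenter G T z
    Zz = proj₂ (same z) refl

    open Centre d diam 4≤d z Zz
      (λ {x} {y} Zx Zy x≢y → contradiction (trans (proj₁ (same x) Zx) (sym (proj₁ (same y) Zy))) x≢y)

    cut : Cut z → SameSet (InCenter G AllV) (λ x → x ≡ z)
    cut cz x = (λ c → decidable-stable (x ≟ z) do
                   central ← InCenter⇒central c
                   pure (is-z central))
             , λ { refl → central⇒InCenter (inj₁ Zz) }
      where
      is-z : Z x ⊎ ∃[ y ] (Z y × Twin y x) → x ≡ z
      is-z (inj₁ Zx) = proj₁ (same x) Zx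
      is-z (inj₂ (y , Zy , ¬cy , _)) with proj₁ (same y) Zy
      ... | refl = contradiction cz ¬cy

    non-cut : ¬ Cut z → SameSet (InCenter G AllV) (λ x → x ∈ₛ V1)
    non-cut ¬cz x = (λ c → decidable-stable (x ∈ₛ? V1) do
                       central ← InCenter⇒central c
                       pure (in-V1 central))
                  , λ x∈ → central⇒InCenter (inj₂ (z , Zz , ¬cz , V1 , V2 , K , z∈ , x∈))
      where
      in-V1 : Z x ⊎ ∃[ y ] (Z y × Twin y x) → x ∈ₛ V1
      in-V1 (inj₁ Zx) with proj₁ (same x) Zx
      ... | refl = z∈
      in-V1 (inj₂ (y , Zy , _ , _ , _ , K' , y∈ , x∈)) with proj₁ (same y) Zy
      ... | refl = non-cut-part-unique K K' z∈ y∈ ¬cz x∈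

  odd : ¬ (2 ∣ d) → ∀ (z₁ z₂ : Fin n) B V1 V2 → IsBlock G B → IsCompleteBipartition G B V1 V2
    → z₁ ∈ₛ V1 → z₂ ∈ₛ V2 → SameSet (InCenter G T) (λ x → (x ≡ z₁) ⊎ (x ≡ z₂))
    → (Cut z₁ → Cut z₂ → SameSet (InCenter G AllV) (λ x → (x ≡ z₁) ⊎ (x ≡ z₂)))
    × (Cut z₁ → ¬ Cut z₂ → SameSet (InCenter G AllV) (λ x → (x ≡ z₁) ⊎ (x ∈ₛ V2)))
    × (¬ Cut z₁ → Cut z₂ → SameSet (InCenter G AllV) (λ x → (x ≡ z₂) ⊎ (x ∈ₛ V1)))
  odd 2∤d z₁ z₂ B V1 V2 blk bip z₁∈ z₂∈ same =
      both-cut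
    , (λ c₁ ¬c₂ → one-cut K Z₁ Z₂ (λ Zx → proj₁ (same _) Zx) z₂∈ c₁ ¬c₂)
    , (λ ¬c₁ c₂ → one-cut (flip K) Z₂ Z₁ (λ Zx → swap (proj₁ (same _) Zx)) z₁∈ c₂ ¬c₁)
    where
    K : Parts V1 V2
    K = record { block = blk ; bipartition = bip }

    5≤d : 5 ≤ d
    -- The value 4 is excluded because it is divisible by 2.
    5≤d = ≤∧≢⇒< 4≤d λ { refl → 2∤d (divides 2 refl) }

    Z₁ : InCenter G T z₁
    Z₁ = proj₂ (same z₁) (inj₁ refl)

    Z₂ : InCenter G T z₂
    Z₂ = proj₂ (same z₂) (inj₂ refl)

    pair : ∀ {x y} → InCenter G T x → InCenter G T y → x ≢ y → Adj G x y × 5 ≤ d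
    pair {x} {y} Zx Zy x≢y with proj₁ (same x) Zx | proj₁ (same y) Zy
    ... | inj₁ refl | inj₁ refl = contradiction refl x≢y
    ... | inj₁ refl | inj₂ refl = Parts.cross K z₁∈ z₂∈ , 5≤d
    ... | inj₂ refl | inj₁ refl = ~sym (Parts.cross K z₁∈ z₂∈) , 5≤d
    ... | inj₂ refl | inj₂ refl = contradiction refl x≢y

    open Centre d diam 4≤d z₁ Z₁ pair

    both-cut : Cut z₁ → Cut z₂ → SameSet (InCenter G AllV) (λ x → (x ≡ z₁) ⊎ (x ≡ z₂))
    both-cut c₁ c₂ x = (λ c → decidable-stable ((x ≟ z₁) ⊎-dec (x ≟ z₂)) do
                          central ← InCenter⇒central c
                          pure (is-centre central))
                     , λ x≡ → central⇒InCenter (inj₁ (proj₂ (same x) x≡))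
      where
      is-centre : Z x ⊎ ∃[ y ] (Z y × Twin y x) → x ≡ z₁ ⊎ x ≡ z₂
      is-centre (inj₁ Zx) = proj₁ (same x) Zx
      is-centre (inj₂ (y , Zy , ¬cy , _)) with proj₁ (same y) Zy
      ... | inj₁ refl = contradiction c₁ ¬cy
      ... | inj₂ refl = contradiction c₂ ¬cy

    -- Stated for an ordered pair of parts, so that the two mixed cases differ by `flip K`. The
    -- cut-vertex `a` has no twins, and those of `b` fill `W`.
    one-cut : ∀ {V W a b} → Parts V W → Z a → Z b → (∀ {x} → Z x → x ≡ a ⊎ x ≡ b) → b ∈ₛ W → Cut a → ¬ Cut b
      → SameSet (InCenter G AllV) (λ x → (x ≡ a) ⊎ (x ∈ₛ W))
    one-cut {V} {W} {a} {b} K Za Zb Z⇒ b∈ ca ¬cb x =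
        (λ c → decidable-stable ((x ≟ a) ⊎-dec (x ∈ₛ? W)) do
           central ← InCenter⇒central c
           pure (is-centre central))
      , λ { (inj₁ refl) → central⇒InCenter (inj₁ Za)
          ; (inj₂ x∈) → central⇒InCenter (inj₂ (b , Zb , ¬cb , _ , _ , flip K , b∈ , x∈)) }
      where
      is-centre : Z x ⊎ ∃[ y ] (Z y × Twin y x) → x ≡ a ⊎ x ∈ₛ W
      is-centre (inj₁ Zx) with Z⇒ Zx
      ... | inj₁ x≡a = inj₁ x≡a
      ... | inj₂ refl = inj₂ b∈
      is-centre (inj₂ (y , Zy , ¬cy , _ , _ , K' , y∈ , x∈)) with Z⇒ Zy
      ... | inj₁ refl = contradiction ca ¬cy
      ... | inj₂ refl = inj₂ (non-cut-part-unique (flip K) K' b∈ y∈ ¬cb x∈)
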